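{- The First-Fit algorithm has an asymptotic competitive ratio of at most $\frac{577087}{261120}<2.211$ for dynamic packing of power-fraction squares. That is, there is an absolute constant $b$ such that $\mathrm{FF}(\sigma)\le \frac{577087}{261120}\,\mathrm{OPT}(\sigma)+b$ for every input sequence $\sigma$ of arrivals and departures of power-fraction squares, where $\mathrm{FF}$ denotes the First-Fit algorithm.
   Context: A power-fraction square is a square of side $\frac{1}{2^k}$ for some integer $k\ge 0$. **Model.** A bin is a unit square. An input $\sigma$ is a finite sequence of arrivals and departures of squares. An arriving item must be immediately packed (without overlap) into a bin; a departing item (one currently present) is removed from its bin. The online algorithm does not know future arrivals or departures. When an item is placed in a bin, the items currently in that same bin may be rearranged within it; items never move between bins, and no repacking takes place at departures. A bin is active at a moment if it contains at least one item at that moment. $\mathrm{OPT}(\sigma)$ is the maximum number, over all moments, of active bins used by an optimal offline algorithm, which knows $\sigma$ in advance and may rearrange items arbitrarily across all bins at any time. For an online algorithm $\mathcal A$, $\mathcal A(\sigma)$ is the maximum number of active bins used by $\mathcal A$ at any moment. $\mathcal A$ has asymptotic competitive ratio $c$ (on a class of inputs) if there is an absolute constant $b$ with $\mathcal A(\sigma)\le c\cdot \mathrm{OPT}(\sigma)+b$ for all $\sigma$ in the class. **First-Fit algorithm.** Bins are ordered by the time at which they are opened (and stay in the order even if they become empty). Each arriving item is packed into the first bin in which it fits; if it does not fit in any existing bin, a new bin is opened. An item fits in a bin if the following procedure succeeds on the multiset $X$ consisting of the item and the items currently in that bin. **Procedure.** Partition the bin into $4$ square cells of side $\frac12$, keep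 $3$ of them, and recursively partition the fourth (so there are three cells of each side $\frac1{2^j}$, $j\ge1$). While there exist $4$ items of the same side $s\le\frac12$ in $X$, merge them into one item of side $2s$. On termination every side $\frac1{2^j}$ with $j\ge 1$ occurs at most $3$ times. If no item of side $1$ remains, place the at most three items of each side $\frac1{2^j}$ in the three cells of that side, and the procedure succeeds. If exactly one item of side $1$ remains and there is no other item, place it alone in the bin, and the procedure succeeds. In every other case the procedure fails. -}

module Defs where

open import Data.Integer.Base as ℤ using (1ℤ)
open import Data.List.Base
  using (List; []; _∷_; _++_; map; concat; filter; length; replicate; head)
open import Data.List.Extrema.Nat using (max)
open import Data.List.Membership.Propositional using (_∈_; _∉_)
open import Data.List.Membership.DecPropositional using (_∈?_)
open import Data.List.Properties using (≡-dec)
open import Data.List.Relation.Binary.Permutation.Propositional using (_↭_; ↭-reflexive; prep)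
open import Data.List.Relation.Unary.All as All using (All; []; _∷_)
open import Data.List.Relation.Unary.AllPairs using (AllPairs; []; _∷_)
open import Data.List.Scans.Base using (scanl)
open import Data.Maybe.Base using (Maybe; just; nothing)
open import Data.Nat.Base using (ℕ; zero; suc; pred; _∸_; _^_; _≤_; s≤s; z≤n; NonZero)
open import Data.Nat.Induction using (<-rec)
open import Data.Nat.Properties using (_≟_; _≤?_; m^n≢0; ≮⇒≥)
open import Data.Product.Base using (∃; ∃-syntax; _×_; _,_)
open import Data.Rational.Base as ℚ using (ℚ; 0ℚ; 1ℚ)
import Data.Rational.Properties as ℚₚ
open import Data.Rational.Unnormalised.Base using (mkℚᵘ; *≤*)
import Data.Rational.Unnormalised.Properties as ℚᵘₚ
open import Data.Sum.Base using (_⊎_; inj₁; inj₂)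
open import Data.Unit.Base using (⊤)
open import Relation.Binary.PropositionalEquality
  using (_≡_; refl; sym; trans; cong; subst)
open import Relation.Nullary using (¬_; Dec; yes; no)
open import Relation.Nullary.Decidable using (¬?; _×-dec_; _⊎-dec_)

------------------------------------------------------------------------
-- Real coordinates, as two-sided Dedekind cuts of ℚ:  L q  means  q < x
-- and  U q  means  x < q.

record ℝ : Set₁ where
  field
    L U       : ℚ → Set
    L-inhab   : ∃ L
    U-inhab   : ∃ U
    L-lower   : ∀ {q r} → q ℚ.< r → L r → L q
    L-rounded : ∀ {q} → L q → ∃[ r ] q ℚ.< r × L r
    U-upper   : ∀ {q r} → q ℚ.< r → U q → U r
    U-rounded : ∀ {r} → U r → ∃[ q ] q ℚ.< r × U q
    disjoint  : ∀ {q} → ¬ (L q × U q)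
    located   : ∀ {q r} → q ℚ.< r → L q ⊎ U r

open ℝ

infix 4 _≤ᴿ_
_≤ᴿ_ : ℝ → ℝ → Set
x ≤ᴿ y = ∀ q → L x q → L y q

fromℚ : ℚ → ℝ
fromℚ p = record
  { L         = ℚ._< p
  ; U         = p ℚ.<_
  ; L-inhab   = p ℚ.- 1ℚ , p-1<p
  ; U-inhab   = p ℚ.+ 1ℚ , p<p+1
  ; L-lower   = ℚₚ.<-trans
  ; L-rounded = λ q<p → let m , q<m , m<p = ℚₚ.<-dense q<p in m , q<m , m<p
  ; U-upper   = λ q<r p<q → ℚₚ.<-trans p<q q<r
  ; U-rounded = λ p<r → let m , p<m , m<r = ℚₚ.<-dense p<r in m , m<r , p<m
  ; disjoint  = λ (q<p , p<q) → ℚₚ.<-asym q<p p<q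
  ; located   = loc
  }
  where
  p-1<p : p ℚ.- 1ℚ ℚ.< p
  p-1<p = subst (p ℚ.- 1ℚ ℚ.<_) (ℚₚ.+-identityʳ p)
            (ℚₚ.+-monoʳ-< p (ℚₚ.neg-antimono-< (ℚₚ.positive⁻¹ 1ℚ)))

  p<p+1 : p ℚ.< p ℚ.+ 1ℚ
  p<p+1 = subst (ℚ._< p ℚ.+ 1ℚ) (ℚₚ.+-identityʳ p)
            (ℚₚ.+-monoʳ-< p (ℚₚ.positive⁻¹ 1ℚ))

  loc : ∀ {q r} → q ℚ.< r → q ℚ.< p ⊎ p ℚ.< r
  loc {q} q<r with q ℚₚ.<? p
  ... | yes q<p = inj₁ q<p
  ... | no  q≮p = inj₂ (ℚₚ.≤-<-trans (ℚₚ.≮⇒≥ q≮p) q<r)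

q-s+s≡q : ∀ q s → q ℚ.- s ℚ.+ s ≡ q
q-s+s≡q q s = trans (ℚₚ.+-assoc q (ℚ.- s) s)
                (trans (cong (q ℚ.+_) (ℚₚ.+-inverseˡ s)) (ℚₚ.+-identityʳ q))

infixl 6 _⊕_
_⊕_ : ℝ → ℚ → ℝ
x ⊕ s = record
  { L         = λ q → L x (q ℚ.- s)
  ; U         = λ q → U x (q ℚ.- s)
  ; L-inhab   = let q , Lq = L-inhab x in q ℚ.+ s , subst (L x) (sym (cancel q)) Lq
  ; U-inhab   = let q , Uq = U-inhab x in q ℚ.+ s , subst (U x) (sym (cancel q)) Uq
  ; L-lower   = λ q<r → L-lower x (shift q<r)
  ; L-rounded = λ {q} Lq → let r , q-s<r , Lr = L-rounded x Lq in
      r ℚ.+ s , subst (ℚ._< r ℚ.+ s) (q-s+s≡q q s) (ℚₚ.+-monoˡ-< s q-s<r)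
              , subst (L x) (sym (cancel r)) Lr
  ; U-upper   = λ q<r → U-upper x (shift q<r)
  ; U-rounded = λ {r} Ur → let q , q<r-s , Uq = U-rounded x Ur in
      q ℚ.+ s , subst (q ℚ.+ s ℚ.<_) (q-s+s≡q r s) (ℚₚ.+-monoˡ-< s q<r-s)
              , subst (U x) (sym (cancel q)) Uq
  ; disjoint  = disjoint x
  ; located   = λ q<r → located x (shift q<r)
  }
  where
  cancel : ∀ q → q ℚ.+ s ℚ.- s ≡ q
  cancel q = trans (ℚₚ.+-assoc q s (ℚ.- s))
               (trans (cong (q ℚ.+_) (ℚₚ.+-inverseʳ s)) (ℚₚ.+-identityʳ q))

  shift : ∀ {q r} → q ℚ.< r → q ℚ.- s ℚ.< r ℚ.- s
  shift = ℚₚ.+-monoˡ-< (ℚ.- s)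

------------------------------------------------------------------------

-- A power-fraction square of side 1/2^exponent; the identifier lets a
-- departure name the item that leaves.
record Item : Set where
  constructor item
  field
    ident    : ℕ
    exponent : ℕ

open Item public

side : Item → ℚ
side i = ℚ._/_ 1ℤ (2 ^ exponent i) {{m^n≢0 2 (exponent i)}}

data Event : Set where
  arrive : Item → Event
  depart : ℕ → Event

discard : ℕ → List Item → List Item
discard n = filter (λ i → ¬? (ident i ≟ n))

update : List Item → Event → List Item
update P (arrive i) = i ∷ P
update P (depart n) = discard n P

-- Identifiers are distinct among the items present at any one moment.
Admissible : List Item → Event → Set
Admissible P (arrive i) = ident i ∉ map ident P
Admissible P (depart n) = n ∈ map ident P

AdmissibleFrom : List Item → List Event → Set
AdmissibleFrom P []      = ⊤
AdmissibleFrom P (e ∷ σ) = Admissible P e × AdmissibleFrom (update P e) σ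

record Input : Set where
  field
    events     : List Event
    admissible : AdmissibleFrom [] events

open Input public

-- The items present at each moment: initially, and after each event.
moments : Input → List (List Item)
moments σ = scanl update [] (events σ)

-- A bin is represented by the list of its contents.
active : ∀ {a} {A : Set a} → List (List A) → ℕ
active []             = 0
active ([]      ∷ Bs) = active Bs
active ((_ ∷ _) ∷ Bs) = suc (active Bs)

------------------------------------------------------------------------

-- The axis-parallel square [xpos , xpos + side] × [ypos , ypos + side].
record Placed : Set₁ where
  constructor placed
  field
    content   : Item
    xpos ypos : ℝ

open Placed public

InsideBin : Placed → Set
InsideBin (placed i x y) =
  (fromℚ 0ℚ ≤ᴿ x × x ⊕ side i ≤ᴿ fromℚ 1ℚ) ×
  (fromℚ 0ℚ ≤ᴿ y × y ⊕ side i ≤ᴿ fromℚ 1ℚ)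

-- Disjoint interiors; boundaries may touch.
NonOverlapping : Placed → Placed → Set
NonOverlapping (placed i x y) (placed j x′ y′) =
  (x ⊕ side i ≤ᴿ x′ ⊎ x′ ⊕ side j ≤ᴿ x) ⊎
  (y ⊕ side i ≤ᴿ y′ ⊎ y′ ⊕ side j ≤ᴿ y)

record Packing (P : List Item) : Set₁ where
  field
    bins           : List (List Placed)
    contents       : map content (concat bins) ↭ P
    inside         : All (All InsideBin) bins
    nonoverlapping : All (AllPairs NonOverlapping) bins

open Packing public

-- Offline, all items may be rearranged across all bins at any time, so a
-- run is an arbitrary choice of a packing at every moment.
OfflineRun : Input → Set₁
OfflineRun σ = All Packing (moments σ)

offlineCost : (σ : Input) → OfflineRun σ → ℕ
offlineCost σ run = max 0 (All.reduce (λ p → active (bins p)) run)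

IsOPT : Input → ℕ → Set₁
IsOPT σ m = (∃[ run ] offlineCost σ run ≡ m) × (∀ run → m ≤ offlineCost σ run)

-- IsOPT is never vacuous.  Only the double negation is proved, because the
-- least cost is obtained without deciding which packings exist.
OPT-exists : ∀ σ → ¬ ¬ ∃ (IsOPT σ)
OPT-exists σ noOPT = noRun _ (All.universal separate (moments σ)) refl
  where
  1/n≤1 : ∀ n .{{_ : NonZero n}} → 1ℤ ℚ./ n ℚ.≤ 1ℚ
  1/n≤1 (suc d) = ℚₚ.toℚᵘ-cancel-≤
    (ℚᵘₚ.≤-respˡ-≃ (ℚᵘₚ.≃-sym (ℚₚ.toℚᵘ-fromℚᵘ (mkℚᵘ 1ℤ d)))
      (*≤* (ℤ.+≤+ (s≤s z≤n))))

  side≤1 : ∀ i → side i ℚ.≤ 1ℚ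
  side≤1 i = 1/n≤1 (2 ^ exponent i) {{m^n≢0 2 (exponent i)}}

  fits : ∀ i → fromℚ 0ℚ ⊕ side i ≤ᴿ fromℚ 1ℚ
  fits i q q-s<0 = ℚₚ.<-≤-trans
    (subst (q ℚ.<_) (ℚₚ.+-identityˡ (side i))
      (subst (ℚ._< 0ℚ ℚ.+ side i) (q-s+s≡q q (side i))
        (ℚₚ.+-monoˡ-< (side i) q-s<0)))
    (side≤1 i)

  atOrigin : Item → Placed
  atOrigin i = placed i (fromℚ 0ℚ) (fromℚ 0ℚ)

  atOrigin-inside : ∀ i → InsideBin (atOrigin i)
  atOrigin-inside i = ((λ _ q<0 → q<0) , fits i) , ((λ _ q<0 → q<0) , fits i)

  separate : ∀ P → Packing P
  separate []      = record
    { bins = [] ; contents = ↭-reflexive refl ; inside = [] ; nonoverlapping = [] }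
  separate (i ∷ P) = let p = separate P in record
    { bins           = (atOrigin i ∷ []) ∷ bins p
    ; contents       = prep i (contents p)
    ; inside         = (atOrigin-inside i ∷ []) ∷ inside p
    ; nonoverlapping = ([] ∷ []) ∷ nonoverlapping p
    }

  noRun : ∀ m run → ¬ (offlineCost σ run ≡ m)
  noRun = <-rec _ λ m rec run eq →
    noOPT (m , (run , eq) , λ run′ → ≮⇒≥ (λ lt → rec lt run′ refl))

------------------------------------------------------------------------
-- Multisets of sides are lists of exponents.

occurrences : ℕ → List ℕ → ℕ
occurrences k X = length (filter (k ≟_) X)

-- The exponent of the first item in the list having at least four copies;
-- the outcome of merging does not depend on which is chosen.
mergeable : List ℕ → Maybe ℕ
mergeable X = head (filter (λ k → (1 ≤? k) ×-dec (4 ≤? occurrences k X)) X)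

mergeFour : ℕ → List ℕ → List ℕ
mergeFour k X =
  pred k ∷ replicate (occurrences k X ∸ 4) k ++ filter (λ j → ¬? (k ≟ j)) X

mergeUpTo : ℕ → List ℕ → List ℕ
mergeUpTo zero    X = X
mergeUpTo (suc n) X with mergeable X
... | just k  = mergeUpTo n (mergeFour k X)
... | nothing = X

-- Each merge shortens the list by three, so the bound  length X  on the
-- number of merges is never what stops the loop.
mergeAll : List ℕ → List ℕ
mergeAll X = mergeUpTo (length X) X

-- Tested after merging: either no item of side 1 remains, or such an item
-- is all that remains.
Placeable : List ℕ → Set
Placeable Y = 0 ∉ Y ⊎ Y ≡ 0 ∷ []

placeable? : ∀ Y → Dec (Placeable Y)
placeable? Y = ¬? (_∈?_ _≟_ 0 Y) ⊎-dec ≡-dec _≟_ Y (0 ∷ [])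

ProcedureSucceeds : List Item → Set
ProcedureSucceeds X = Placeable (mergeAll (map exponent X))

procedureSucceeds? : ∀ X → Dec (ProcedureSucceeds X)
procedureSucceeds? X = placeable? (mergeAll (map exponent X))

firstFit : Item → List (List Item) → List (List Item)
firstFit i []       = (i ∷ []) ∷ []
firstFit i (B ∷ Bs) with procedureSucceeds? (i ∷ B)
... | yes _ = (i ∷ B) ∷ Bs
... | no  _ = B ∷ firstFit i Bs

-- Bins are kept in order of opening, including those that became empty.
stepFF : List (List Item) → Event → List (List Item)
stepFF Bs (arrive i) = firstFit i Bs
stepFF Bs (depart n) = map (discard n) Bs

FF : Input → ℕ
FF σ = max 0 (map active (scanl stepFF [] (events σ)))

------------------------------------------------------------------------

ℕ→ℚ : ℕ → ℚ
ℕ→ℚ n = ℤ.+ n ℚ./ 1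

AsymptoticRatioAtMost : (Input → ℕ) → ℚ → Set₁
AsymptoticRatioAtMost A c =
  ∃[ b ] ∀ σ opt → IsOPT σ opt → ℕ→ℚ (A σ) ℚ.≤ c ℚ.* ℕ→ℚ opt ℚ.+ b

{-# OPTIONS --safe #-}
module Submission where

-- By area, the procedure succeeds exactly when the squares have total area at
-- most 1, and OPT is at least the total area present at any moment; for
-- offline packings at real coordinates this follows by rounding positions to
-- a grid whose mesh tends to 0.
--
-- For k ≤ 4 let pₖ be such that all squares ever put beyond the first pₖ
-- bins have side more than 2⁻ᵏ.  When First-Fit puts a square of side at most
-- 2⁻ᵏ into the pₖ-th bin, every earlier bin has load more than 1 − 4⁻ᵏ.  If only
-- squares of side at least 2⁻ʲ, k ≤ j < 4, occur in it, then its load is a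
-- multiple of 4⁻ʲ, hence at least 1 − 4⁻ᵏ + 4⁻ʲ.  Summing over the bins,
--   pₖ ≤ OPT + 1 + Σ_{k<j≤4} 3·4⁻ʲ pⱼ + 4⁻⁴ p₄.
-- These inequalities survive any later growth of the pⱼ with j > k, and
-- solving them from k = 4 down to k = 0 bounds the number p₀ of bins.  In the
-- code q d = p₍₄₋d₎, and everything is scaled to natural numbers.

open import Defs
open import Data.Integer.Base as ℤ using (1ℤ)
import Data.Integer.Properties as ℤ
open import Data.List.Base
  using (List; []; _∷_; _++_; map; concat; filter; length; replicate; head; drop; applyUpTo; upTo; cartesianProduct)
open import Data.List.Extrema.Nat using (max; xs≤max; argmax-all)
open import Data.List.Membership.DecPropositional using (_∈?_)
open import Data.List.Membership.Propositional using (_∈_)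
open import Data.List.Membership.Propositional.Properties
  using (∈-∃++; ∈-++⁻; ∈-++⁺ˡ; ∈-++⁺ʳ; ∈-cartesianProduct⁺; ∈-cartesianProduct⁻;
         ∈-applyUpTo⁻; ∈-upTo⁺; ∈-concat⁻′; ∈-map⁻)
open import Data.List.Properties
  using (filter-accept; filter-reject; filter-++; map-++; map-cong; map-∘; drop-map; drop-drop;
         length-++; length-++-sucʳ; length-map; length-applyUpTo; length-upTo)
open import Data.List.Relation.Binary.Disjoint.Propositional using (Disjoint)
open import Data.List.Relation.Binary.Permutation.Propositional
  using (_↭_; ↭-refl; ↭-trans; ↭-reflexive; ↭-sym; prep)
open import Data.List.Relation.Binary.Permutation.Propositional.Properties
  using (map⁺; filter-↭; shift; ++⁺ˡ; All-resp-↭)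
open import Data.List.Relation.Binary.Subset.Propositional using (_⊆_)
open import Data.List.Relation.Unary.All as All using (All; []; _∷_)
import Data.List.Relation.Unary.All.Properties as All
open import Data.List.Relation.Unary.AllPairs as AllPairs using (AllPairs; []; _∷_)
import Data.List.Relation.Unary.AllPairs.Properties as AllPairs
open import Data.List.Relation.Unary.Any using (here; there)
open import Data.List.Relation.Unary.Unique.Propositional using (Unique)
import Data.List.Relation.Unary.Unique.Propositional.Properties as Unique
open import Data.List.Scans.Base using (scanl)
open import Data.Maybe.Base using (just; nothing)
open import Data.Nat.Base as ℕ hiding (_/_; _<_)
open import Data.Nat.Divisibility
  using (_∣_; divides; ∣m∣n⇒∣m+n; ∣n⇒∣m*n; ∣-trans; m∣m*n; n∣m*n; _∣0; *-monoˡ-∣)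
open import Data.Nat.ListAction using (sum)
open import Data.Nat.ListAction.Properties using (sum-++; sum-↭)
open import Data.Nat.Properties
open import Data.Nat.Tactic.RingSolver using (solve-∀)
open import Data.Product.Base using (_×_; _,_; ∃-syntax; proj₁; proj₂)
open import Data.Rational.Base as ℚ using (ℚ; 0ℚ; 1ℚ; _/_; _<_)
import Data.Rational.Properties as ℚ
open import Data.Rational.Solver using (module +-*-Solver)
import Data.Rational.Unnormalised.Base as ℚᵘ
import Data.Rational.Unnormalised.Properties as ℚᵘ
open import Data.Sum.Base using (_⊎_; inj₁; inj₂)
open import Function.Base using (case_of_)
open import Relation.Binary.Definitions using (tri<; tri≈; tri>)
open import Relation.Binary.PropositionalEquality
open import Relation.Nullary using (¬_; yes; no; contradiction)
open import Relation.Nullary.Decidable using (¬?; _×-dec_; from-yes)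
open import Relation.Unary using (Pred)
open import Algebra.Properties.Monoid.Mult ℚ.+-0-monoid using (×-homo-+; ×-assocˡ) renaming (_×_ to _·_)

open ℝ

-- Area and the merging procedure

-- Areas are measured in units of 4⁻ᴺ; an exponent above N has junk weight 1.
weight : ℕ → List ℕ → ℕ
weight N X = sum (map (λ e → 4 ^ (N ∸ e)) X)

weight-++ : ∀ N X Y → weight N (X ++ Y) ≡ weight N X + weight N Y
weight-++ N X Y = trans (cong sum (map-++ _ X Y)) (sum-++ (map _ X) (map _ Y))

weight-replicate : ∀ N n k → weight N (replicate n k) ≡ n * 4 ^ (N ∸ k)
weight-replicate N zero    k = refl
weight-replicate N (suc n) k = cong (4 ^ (N ∸ k) +_) (weight-replicate N n k)

weight-occurrences : ∀ N k X →
  weight N X ≡ occurrences k X * 4 ^ (N ∸ k) + weight N (filter (λ j → ¬? (k ≟ j)) X)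
weight-occurrences N k []      = refl
weight-occurrences N k (x ∷ X) with k ≟ x
... | yes refl
  rewrite filter-accept (k ≟_) {xs = X} refl
        | filter-reject (λ j → ¬? (k ≟ j)) {xs = X} (λ k≢k → k≢k refl)
  = trans (cong (4 ^ (N ∸ k) +_) (weight-occurrences N k X)) (sym (+-assoc (4 ^ (N ∸ k)) _ _))
... | no k≢x
  rewrite filter-reject (k ≟_) {xs = X} k≢x
        | filter-accept (λ j → ¬? (k ≟ j)) {xs = X} k≢x
        | weight-occurrences N k X
  = solve-+ (4 ^ (N ∸ x)) (occurrences k X * 4 ^ (N ∸ k)) (weight N (filter (λ j → ¬? (k ≟ j)) X))
  where
  solve-+ : ∀ a b c → a + (b + c) ≡ b + (a + c)
  solve-+ = solve-∀

-- Equality holds for `k` at most `N`. Above `N` both truncated powers are the junk value 1, and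
-- only the inequality remains.
weight-pred : ∀ N k → 1 ≤ k → 4 ^ (N ∸ pred k) ≤ 4 * 4 ^ (N ∸ k)
weight-pred N (suc k) _ = ^-monoʳ-≤ 4 (bound N k)
  where
  bound : ∀ N k → N ∸ k ≤ suc (N ∸ suc k)
  bound zero    k       = subst (_≤ suc (0 ∸ suc k)) (sym (0∸n≡0 k)) z≤n
  bound (suc N) zero    = ≤-refl
  bound (suc N) (suc k) = bound N k

weight-mergeFour : ∀ N k X → 1 ≤ k → 4 ≤ occurrences k X → weight N (mergeFour k X) ≤ weight N X
weight-mergeFour N k X 1≤k 4≤occ = begin
  4 ^ (N ∸ pred k) + weight N (replicate (o ∸ 4) k ++ rest)
    ≡⟨ cong (4 ^ (N ∸ pred k) +_) (weight-++ N (replicate (o ∸ 4) k) rest) ⟩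
  4 ^ (N ∸ pred k) + (weight N (replicate (o ∸ 4) k) + weight N rest)
    ≡⟨ cong (λ t → 4 ^ (N ∸ pred k) + (t + weight N rest)) (weight-replicate N (o ∸ 4) k) ⟩
  4 ^ (N ∸ pred k) + ((o ∸ 4) * w + weight N rest)
    ≤⟨ +-monoˡ-≤ _ (weight-pred N k 1≤k) ⟩
  4 * w + ((o ∸ 4) * w + weight N rest)
    ≡⟨ +-assoc (4 * w) _ _ ⟨
  4 * w + (o ∸ 4) * w + weight N rest
    ≡⟨ cong (_+ weight N rest) (*-distribʳ-+ w 4 (o ∸ 4)) ⟨
  (4 + (o ∸ 4)) * w + weight N rest
    ≡⟨ cong (λ t → t * w + weight N rest) (m+[n∸m]≡n 4≤occ) ⟩
  o * w + weight N rest
    ≡⟨ weight-occurrences N k X ⟨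
  weight N X ∎
  where
  open ≤-Reasoning
  o = occurrences k X
  w = 4 ^ (N ∸ k)
  rest = filter (λ j → ¬? (k ≟ j)) X

head-All : ∀ {a p} {A : Set a} {P : Pred A p} {xs x} → All P xs → head xs ≡ just x → P x
head-All (px ∷ _) refl = px

mergeable-just : ∀ X {k} → mergeable X ≡ just k → 1 ≤ k × 4 ≤ occurrences k X
mergeable-just X = head-All (All.all-filter (λ k → (1 ≤? k) ×-dec (4 ≤? occurrences k X)) X)

weight-mergeUpTo : ∀ N n X → weight N (mergeUpTo n X) ≤ weight N X
weight-mergeUpTo N zero    X = ≤-refl
weight-mergeUpTo N (suc n) X with mergeable X in eq
... | nothing = ≤-refl
... | just k  = let 1≤k , 4≤occ = mergeable-just X eq in
  ≤-trans (weight-mergeUpTo N n (mergeFour k X)) (weight-mergeFour N k X 1≤k 4≤occ)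

weight-positive : ∀ N x X → 0 ℕ.< weight N (x ∷ X)
weight-positive N x X = ≤-trans (m^n>0 4 (N ∸ x)) (m≤m+n _ _)

weight≡0 : ∀ N X → weight N X ≤ 0 → X ≡ []
weight≡0 N []      _ = refl
weight≡0 N (x ∷ X) p = contradiction (≤-trans (weight-positive N x X) p) λ ()

-- A square of side 1 already weighs 4ᴺ, so the entries around it weigh 0; as every weight is
-- positive, there are none.
light⇒placeable : ∀ N Y → weight N Y ≤ 4 ^ N → Placeable Y
light⇒placeable N Y light with _∈?_ _≟_ 0 Y
... | no  0∉Y = inj₁ 0∉Y
... | yes 0∈Y with ∈-∃++ 0∈Y
...   | Y₁ , Y₂ , refl = inj₂ (cong₂ (λ V W → V ++ 0 ∷ W)
          (weight≡0 N Y₁ (≤-trans (m≤m+n _ _) others)) (weight≡0 N Y₂ (≤-trans (m≤n+m _ _) others)))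
  where
  open ≤-Reasoning
  others : weight N Y₁ + weight N Y₂ ≤ 0
  others = +-cancelʳ-≤ (4 ^ N) _ _ (begin
    weight N Y₁ + weight N Y₂ + 4 ^ N    ≡⟨ +-assoc (weight N Y₁) _ _ ⟩
    weight N Y₁ + (weight N Y₂ + 4 ^ N)  ≡⟨ cong (weight N Y₁ +_) (+-comm (weight N Y₂) _) ⟩
    weight N Y₁ + weight N (0 ∷ Y₂)      ≡⟨ weight-++ N Y₁ (0 ∷ Y₂) ⟨
    weight N (Y₁ ++ 0 ∷ Y₂)              ≤⟨ light ⟩
    4 ^ N                                ∎)

load : ℕ → List Item → ℕ
load N B = weight N (map exponent B)

-- Merging never increases weight, so an input of weight at most 4ᴺ ends placeable.
procedureFails⇒heavy : ∀ N X → ¬ ProcedureSucceeds X → 4 ^ N ℕ.< load N X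
procedureFails⇒heavy N X fails = ≰⇒> λ light →
  fails (light⇒placeable N _ (≤-trans (weight-mergeUpTo N (length (map exponent X)) _) light))

load-++ : ∀ N B C → load N (B ++ C) ≡ load N B + load N C
load-++ N B C = trans (cong (weight N) (map-++ exponent B C)) (weight-++ N (map exponent B) _)

load-↭ : ∀ N {B C} → B ↭ C → load N B ≡ load N C
load-↭ N p = sum-↭ (map⁺ _ (map⁺ exponent p))

totalLoad : ℕ → List (List Item) → ℕ
totalLoad N Bs = sum (map (load N) Bs)

totalLoad-concat : ∀ N Bs → totalLoad N Bs ≡ load N (concat Bs)
totalLoad-concat N []       = refl
totalLoad-concat N (B ∷ Bs) =
  trans (cong (load N B +_) (totalLoad-concat N Bs)) (sym (load-++ N B (concat Bs)))

∣-load : ∀ {g} N B → All (λ i → g ∣ 4 ^ (N ∸ exponent i)) B → g ∣ load N B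
∣-load N []      []       = _ ∣0
∣-load N (i ∷ B) (p ∷ ps) = ∣m∣n⇒∣m+n p (∣-load N B ps)

-- The First-Fit invariant

-- 4ᴷ times the sum Σ_{k<j≤K} 3·4⁻ʲ pⱼ + 4⁻ᴷ p_K, for d = K − k and q d = p₍K₋d₎.
slack : (ℕ → ℕ) → ℕ → ℕ
slack q zero    = q 0
slack q (suc d) = slack q d + 3 * 4 ^ d * q d

slack-mono : ∀ {q q′} d → (∀ d → q d ≤ q′ d) → slack q d ≤ slack q′ d
slack-mono zero    q≤q′ = q≤q′ 0
slack-mono (suc d) q≤q′ = +-mono-≤ (slack-mono d q≤q′) (*-monoʳ-≤ (3 * 4 ^ d) (q≤q′ d))

-- Linearity in `q` lets the estimate for a single bin be summed over the bins.
slack-+ : ∀ {q q₁ q₂} d → (∀ d → q d ≡ q₁ d + q₂ d) → slack q d ≡ slack q₁ d + slack q₂ d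
slack-+ zero q≡ = q≡ 0
slack-+ {q} {q₁} {q₂} (suc d) q≡
  rewrite slack-+ d q≡ | q≡ d = lemma (slack q₁ d) (slack q₂ d) (3 * 4 ^ d) (q₁ d) (q₂ d)
  where
  lemma : ∀ a b c x y → a + b + c * (x + y) ≡ a + c * x + (b + c * y)
  lemma = solve-∀

-- Between multiples of `g`, a shortfall below `g` is no shortfall. This granularity is what
-- improves the bare area estimate for a bin that rejects a square.
multiple-gap : ∀ {g U L} → g ∣ U → g ∣ L → U ℕ.< L + g → U ≤ L
multiple-gap {g} (divides a refl) (divides b refl) lt =
  *-monoˡ-≤ g (s≤s⁻¹ (*-cancelʳ-< g a (suc b) (subst (a * g ℕ.<_) (+-comm (b * g) g) lt)))

4^-split : ∀ {m n} → m ≤ n → 4 ^ n ≡ 4 ^ m * 4 ^ (n ∸ m)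
4^-split {m} {n} m≤n = trans (cong (4 ^_) (sym (m+[n∸m]≡n m≤n))) (^-distribˡ-+-* 4 m (n ∸ m))

4^-∣ : ∀ {m n} → m ≤ n → 4 ^ m ∣ 4 ^ n
4^-∣ {m} {n} m≤n = subst (4 ^ m ∣_) (sym (4^-split m≤n)) (m∣m*n (4 ^ (n ∸ m)))

m∸[n∸o]≡o+[m∸n] : ∀ {m n o} → n ≤ m → o ≤ n → m ∸ (n ∸ o) ≡ o + (m ∸ n)
m∸[n∸o]≡o+[m∸n] {m} {n} {o} n≤m o≤n = begin
  m ∸ (n ∸ o)                      ≡⟨ cong (_∸ (n ∸ o)) (m+[n∸m]≡n n≤m) ⟨
  n + (m ∸ n) ∸ (n ∸ o)            ≡⟨ cong (λ k → k + (m ∸ n) ∸ (n ∸ o)) (m+[n∸m]≡n o≤n) ⟨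
  o + (n ∸ o) + (m ∸ n) ∸ (n ∸ o)  ≡⟨ cong (_∸ (n ∸ o)) (solve-+ o (n ∸ o) (m ∸ n)) ⟩
  o + (m ∸ n) + (n ∸ o) ∸ (n ∸ o)  ≡⟨ m+n∸n≡m (o + (m ∸ n)) (n ∸ o) ⟩
  o + (m ∸ n)                      ∎
  where
  open ≡-Reasoning
  solve-+ : ∀ a b c → a + b + c ≡ a + c + b
  solve-+ = solve-∀

-- With L the load of a bin and u = 4ᴺ⁻ᴷ: L is too large for another square
-- of area 4ᵈu, and χ d′ = 0 certifies that the bin only has squares of area at
-- least 4 · 4ᵈ′u.
fullness : ∀ u K χ d L → d ≤ K →
  (∀ d′ → d′ ℕ.< d → χ d′ ≡ 0 → 4 ^ suc d′ * u ∣ L) → (χ 0 ≡ 0 → u ∣ L) →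
  4 ^ K * u ℕ.< L + 4 ^ d * u → 4 ^ K * u ≤ L + slack χ d * u
fullness u K χ zero L _ _ u∣L lt with χ 0
... | zero  = ≤-trans
  (multiple-gap (n∣m*n (4 ^ K)) (u∣L refl) (subst (λ t → 4 ^ K * u ℕ.< L + t) (*-identityˡ u) lt)) (m≤m+n L 0)
... | suc n = ≤-trans (<⇒≤ lt) (+-monoʳ-≤ L (*-monoˡ-≤ u (s≤s (z≤n {n}))))
fullness u K χ (suc d) L d<K div u∣L lt with χ d in χd≡
... | zero  = ≤-trans (multiple-gap (*-monoˡ-∣ u (4^-∣ d<K)) (div d ≤-refl χd≡) lt) (m≤m+n L _)
-- Squares of area 4ᵈu may occur in the bin. Adding three of them to `L` on paper turns the gap
-- 4ᵈ⁺¹u into 4ᵈu, keeps divisibility by the smaller powers, and is paid for by the last term of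
-- `slack`.
... | suc n = begin
  4 ^ K * u
    ≤⟨ fullness u K χ d (L + 3 * 4 ^ d * u) (<⇒≤ d<K)
         (λ d′ d′<d χd′≡0 → ∣m∣n⇒∣m+n (div d′ (m<n⇒m<1+n d′<d) χd′≡0) (∣extra d′<d))
         (λ χ0≡0 → ∣m∣n⇒∣m+n (u∣L χ0≡0) (n∣m*n (3 * 4 ^ d)))
         (subst (4 ^ K * u ℕ.<_) (regroup L (4 ^ d) u) lt) ⟩
  L + 3 * 4 ^ d * u + slack χ d * u        ≡⟨ collect L (3 * 4 ^ d) (slack χ d) u ⟩
  L + (slack χ d + 3 * 4 ^ d * 1) * u
    ≤⟨ +-monoʳ-≤ L (*-monoˡ-≤ u (+-monoʳ-≤ (slack χ d) (*-monoʳ-≤ (3 * 4 ^ d) (s≤s (z≤n {n}))))) ⟩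
  L + (slack χ d + 3 * 4 ^ d * suc n) * u  ∎
  where
  open ≤-Reasoning
  regroup : ∀ L c u → L + 4 * c * u ≡ L + 3 * c * u + c * u
  regroup = solve-∀
  collect : ∀ L c s u → L + c * u + s * u ≡ L + (s + c * 1) * u
  collect = solve-∀
  ∣extra : ∀ {d′} → d′ ℕ.< d → 4 ^ suc d′ * u ∣ 3 * 4 ^ d * u
  ∣extra {d′} d′<d = subst (4 ^ suc d′ * u ∣_) (sym (*-assoc 3 (4 ^ d) u)) (∣n⇒∣m*n 3 (*-monoˡ-∣ u (4^-∣ d′<d)))

-- The area of P is at most m.
Dominated : List Item → ℕ → Set
Dominated P m = ∀ N → All (λ i → exponent i ≤ N) P → load N P ≤ m * 4 ^ N

-- pre lists the bins passed over when First-Fit turns Bs into Bs′.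
data Packs (i : Item) : (pre Bs Bs′ : List (List Item)) → Set where
  opens  : Packs i [] [] ((i ∷ []) ∷ [])
  fits   : ∀ {B Bs} → Packs i [] (B ∷ Bs) ((i ∷ B) ∷ Bs)
  passes : ∀ {B pre Bs Bs′} → ¬ ProcedureSucceeds (i ∷ B) →
           Packs i pre Bs Bs′ → Packs i (B ∷ pre) (B ∷ Bs) (B ∷ Bs′)

firstFit-packs : ∀ i Bs → ∃[ pre ] Packs i pre Bs (firstFit i Bs)
firstFit-packs i []       = [] , opens
firstFit-packs i (B ∷ Bs) with procedureSucceeds? (i ∷ B)
... | yes _     = [] , fits
... | no  fails = let pre , p = firstFit-packs i Bs in B ∷ pre , passes fails p

module _ {i : Item} where

  packs-full : ∀ {pre Bs Bs′} → Packs i pre Bs Bs′ → All (λ B → ¬ ProcedureSucceeds (i ∷ B)) pre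
  packs-full opens            = []
  packs-full fits             = []
  packs-full (passes fails p) = fails ∷ packs-full p

  packs-totalLoad : ∀ {pre Bs Bs′} N → Packs i pre Bs Bs′ → totalLoad N pre ≤ totalLoad N Bs
  packs-totalLoad N opens                = z≤n
  packs-totalLoad N fits                 = z≤n
  packs-totalLoad N (passes {B = B} _ p) = +-monoʳ-≤ (load N B) (packs-totalLoad N p)

  packs-concat : ∀ {pre Bs Bs′} → Packs i pre Bs Bs′ → concat Bs′ ↭ i ∷ concat Bs
  packs-concat opens = ↭-refl
  packs-concat fits  = ↭-refl
  packs-concat (passes {B = B} _ p) = ↭-trans (++⁺ˡ B (packs-concat p)) (shift i B _)

  -- A bin is opened only after all existing ones have been passed over.
  packs-length : ∀ {pre Bs Bs′} → Packs i pre Bs Bs′ → length Bs′ ≤ length Bs ⊔ suc (length pre)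
  packs-length opens               = ≤-refl
  packs-length (fits {Bs = Bs})    = m≤m⊔n (suc (length Bs)) 1
  packs-length (passes _ p)        = s≤s (packs-length p)

  module _ {p} {P : Pred (List Item) p} where

    packs-drop-pre : ∀ {pre Bs Bs′} n → Packs i pre Bs Bs′ → All P (drop n Bs) → All P (drop n pre)
    packs-drop-pre zero    opens        _           = []
    packs-drop-pre (suc n) opens        _           = []
    packs-drop-pre zero    fits         _           = []
    packs-drop-pre (suc n) fits         _           = []
    packs-drop-pre zero    (passes _ q) (pB ∷ pBs)  = pB ∷ packs-drop-pre zero q pBs
    packs-drop-pre (suc n) (passes _ q) pBs         = packs-drop-pre n q pBs

    packs-drop-> : ∀ {pre Bs Bs′} n → Packs i pre Bs Bs′ → length pre ℕ.< n →
                   All P (drop n Bs) → All P (drop n Bs′)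
    packs-drop-> (suc zero)    opens        _         pBs = []
    packs-drop-> (suc (suc n)) opens        _         pBs = []
    packs-drop-> (suc n)       fits         _         pBs = pBs
    packs-drop-> (suc n)       (passes _ q) (s≤s lt)  pBs = packs-drop-> n q lt pBs

  packs-drop-All : ∀ {p} {P : Pred Item p} {pre Bs Bs′} n → Packs i pre Bs Bs′ → P i →
                   All (All P) (drop n Bs) → All (All P) (drop n Bs′)
  packs-drop-All zero          opens        pi _          = (pi ∷ []) ∷ []
  packs-drop-All (suc zero)    opens        pi _          = []
  packs-drop-All (suc (suc n)) opens        pi _          = []
  packs-drop-All zero          fits         pi (pB ∷ pBs) = (pi ∷ pB) ∷ pBs
  packs-drop-All (suc n)       fits         pi pBs        = pBs
  packs-drop-All zero          (passes _ q) pi (pB ∷ pBs) = pB ∷ packs-drop-All zero q pi pBs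
  packs-drop-All (suc n)       (passes _ q) pi pBs        = packs-drop-All n q pi pBs

All-drop-mono : ∀ {a p} {A : Set a} {P : Pred A p} {m n} (xs : List A) → m ≤ n →
                All P (drop m xs) → All P (drop n xs)
All-drop-mono {m = m} {n} xs m≤n pxs = subst (All _)
  (trans (drop-drop m (n ∸ m) xs) (cong (λ k → drop k xs) (m+[n∸m]≡n m≤n))) (All.drop⁺ (n ∸ m) pxs)

concat-discard : ∀ n Bs → concat (map (discard n) Bs) ≡ discard n (concat Bs)
concat-discard n []       = refl
concat-discard n (B ∷ Bs) = trans (cong (discard n B ++_) (concat-discard n Bs))
  (sym (filter-++ (λ i → ¬? (ident i ≟ n)) B (concat Bs)))

-- Arrivals and departures preserve the invariant

module _ (K : ℕ) where

  Confined : (ℕ → ℕ) → List (List Item) → Set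
  Confined q Bs = ∀ d → All (All (λ i → exponent i ℕ.< K ∸ d)) (drop (q d) Bs)

  -- Each square in `B` has side at least 2 to the power d + 1 - K, so its area is a multiple of
  -- 4ᵈ⁺¹ in units of 4⁻ᴷ; the factor `4 ^ (N ∸ K)` converts to units of 4⁻ᴺ.
  load-divisible : ∀ N d B → K ≤ N → All (λ i → exponent i ℕ.< K ∸ d) B → 4 ^ suc d * 4 ^ (N ∸ K) ∣ load N B
  load-divisible N d B K≤N small = ∣-load N B (All.map divisible small)
    where
    divisible : ∀ {e} → e ℕ.< K ∸ d → 4 ^ suc d * 4 ^ (N ∸ K) ∣ 4 ^ (N ∸ e)
    divisible {e} e<K∸d = subst (_∣ 4 ^ (N ∸ e)) (^-distribˡ-+-* 4 (suc d) (N ∸ K)) (4^-∣ exponents)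
      where
      -- The presence of a square excludes `d` ≥ `K`, where no exponent would lie below `K ∸ d`.
      d<K : d ℕ.< K
      d<K = m∸n≢0⇒n<m λ K∸d≡0 → contradiction (subst (e ℕ.<_) K∸d≡0 e<K∸d) λ ()
      exponents : suc d + (N ∸ K) ≤ N ∸ e
      exponents = subst (_≤ N ∸ e) (m∸[n∸o]≡o+[m∸n] K≤N d<K)
        (∸-monoʳ-≤ N (subst (e ≤_) (pred[m∸n]≡m∸[1+n] K d) (<⇒≤pred e<K∸d)))

  -- The rejected square has area at most 4ᵈu, so failure of the procedure is the strict inequality
  -- that `fullness` expects. Here `q` serves as an indicator: `q d` is 0 when the bin lies beyond
  -- the threshold for `d`.
  fullBin : ∀ N i q d B → K ≤ N → d ≤ K → K ∸ d ≤ exponent i →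
    (∀ d → q d ≡ 0 → All (λ i → exponent i ℕ.< K ∸ d) B) → ¬ ProcedureSucceeds (i ∷ B) →
    4 ^ N ≤ load N B + slack q d * 4 ^ (N ∸ K)
  fullBin N i q d B K≤N d≤K K∸d≤e small fails =
    subst (_≤ load N B + slack q d * u) (sym (4^-split K≤N))
      (fullness u K q d (load N B) d≤K
        (λ d′ _ q≡0 → load-divisible N d′ B K≤N (small d′ q≡0))
        (λ q≡0 → ∣-trans (n∣m*n 4) (load-divisible N 0 B K≤N (small 0 q≡0)))
        (begin-strict
          4 ^ K * u                        ≡⟨ 4^-split K≤N ⟨
          4 ^ N                            <⟨ procedureFails⇒heavy N (i ∷ B) fails ⟩
          4 ^ (N ∸ exponent i) + load N B  ≤⟨ +-monoˡ-≤ (load N B) (^-monoʳ-≤ 4 (∸-monoʳ-≤ N K∸d≤e)) ⟩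
          4 ^ (N ∸ (K ∸ d)) + load N B     ≡⟨ +-comm _ (load N B) ⟩
          load N B + 4 ^ (N ∸ (K ∸ d))     ≡⟨ cong (load N B +_) 4^[N∸[K∸d]] ⟩
          load N B + 4 ^ d * u             ∎))
    where
    open ≤-Reasoning
    u = 4 ^ (N ∸ K)
    4^[N∸[K∸d]] : 4 ^ (N ∸ (K ∸ d)) ≡ 4 ^ d * u
    4^[N∸[K∸d]] = trans (cong (4 ^_) (m∸[n∸o]≡o+[m∸n] K≤N d≤K)) (^-distribˡ-+-* 4 d (N ∸ K))

  -- Induction from the front: each threshold `q d` splits into `1 ⊓ q d`, which tells whether the
  -- first bin lies before it, and `pred (q d)`, the same threshold counted from the second bin.
  fullBins : ∀ N i d pre q → K ≤ N → d ≤ K → K ∸ d ≤ exponent i →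
    Confined q pre → All (λ B → ¬ ProcedureSucceeds (i ∷ B)) pre →
    length pre * 4 ^ N ≤ totalLoad N pre + slack q d * 4 ^ (N ∸ K)
  fullBins N i d []        q K≤N d≤K K∸d≤e conf []             = z≤n
  fullBins N i d (B ∷ pre) q K≤N d≤K K∸d≤e conf (fails ∷ full) = begin
    4 ^ N + length pre * 4 ^ N
      ≤⟨ +-mono-≤
           (fullBin N i (λ d → 1 ⊓ q d) d B K≤N d≤K K∸d≤e atHead fails)
           (fullBins N i d pre (λ d → pred (q d)) K≤N d≤K K∸d≤e atTail full) ⟩
    load N B + s₁ * u + (totalLoad N pre + s₂ * u)
      ≡⟨ regroup (load N B) s₁ u (totalLoad N pre) s₂ ⟩
    load N B + totalLoad N pre + (s₁ + s₂) * u
      ≡⟨ cong (λ s → load N B + totalLoad N pre + s * u) (slack-+ d split) ⟨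
    load N B + totalLoad N pre + slack q d * u  ∎
    where
    open ≤-Reasoning
    u = 4 ^ (N ∸ K)
    s₁ = slack (λ d → 1 ⊓ q d) d
    s₂ = slack (λ d → pred (q d)) d
    regroup : ∀ a s u b t → a + s * u + (b + t * u) ≡ a + b + (s + t) * u
    regroup = solve-∀
    split : ∀ d → q d ≡ 1 ⊓ q d + pred (q d)
    split d with q d
    ... | zero  = refl
    ... | suc _ = refl
    atHead : ∀ d → 1 ⊓ q d ≡ 0 → All (λ i → exponent i ℕ.< K ∸ d) B
    atHead d q≡0 with q d | conf d
    ... | zero  | pB ∷ _ = pB
    ... | suc _ | _      = contradiction q≡0 λ ()
    atTail : Confined (λ d → pred (q d)) pre
    atTail d with q d | conf d
    ... | zero  | _ ∷ pBs = pBs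
    ... | suc _ | pBs     = pBs

  -- A square of exponent `e` put into the `n`-th bin can break confinement only for those `d` with
  -- `K ∸ d` at most `e`; their thresholds are moved out to include that bin.
  raise : (ℕ → ℕ) → ℕ → ℕ → ℕ → ℕ
  raise q e n d with K ∸ d ≤? e
  ... | yes _ = q d ⊔ n
  ... | no  _ = q d

  q≤raise : ∀ q e n d → q d ≤ raise q e n d
  q≤raise q e n d with K ∸ d ≤? e
  ... | yes _ = m≤m⊔n (q d) n
  ... | no  _ = ≤-refl

  -- The thresholds `q` never decrease: departures keep them and arrivals raise them. Confinement at
  -- `d` = `K` only makes the bins beyond `q K` empty; `covered` adds that there are none, since
  -- empty bins keep their place in the list.
  record Invariant (m : ℕ) (Bs : List (List Item)) : Set where
    field
      q        : ℕ → ℕ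
      confined : Confined q Bs
      covered  : length Bs ≤ q K
      bounded  : ∀ d → d ≤ K → 4 ^ K * q d ≤ 4 ^ K * suc m + slack q d

  invariant-[] : ∀ m → Invariant m []
  invariant-[] m = record
    { q        = λ _ → 0
    ; confined = λ _ → []
    ; covered  = z≤n
    ; bounded  = λ d _ → subst (_≤ 4 ^ K * suc m + slack (λ _ → 0) d) (sym (*-zeroʳ (4 ^ K))) z≤n
    }

  invariant-discard : ∀ {m Bs} n → Invariant m Bs → Invariant m (map (discard n) Bs)
  invariant-discard {Bs = Bs} n inv = record
    { q        = q
    ; confined = λ d → subst (All _) (sym (drop-map (q d) Bs))
        (All.map⁺ (All.map (All.filter⁺ (λ i → ¬? (ident i ≟ n))) (confined d)))
    ; covered  = subst (_≤ q K) (sym (length-map (discard n) Bs)) covered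
    ; bounded  = bounded
    }
    where open Invariant inv

  -- A threshold either stays or moves out to the bin receiving `i`. In the second case all earlier
  -- bins rejected `i`, and `fullBins` bounds their number. Growth of other thresholds only enlarges
  -- the right-hand side.
  invariant-firstFit : ∀ {m Bs P} i → Dominated P m → concat Bs ↭ P → Invariant m Bs →
                       Invariant m (firstFit i Bs)
  invariant-firstFit {m} {Bs} {P} i dominated Bs↭P inv with pre , packs ← firstFit-packs i Bs = record
    { q        = q⁺
    ; confined = confined⁺
    ; covered  = ≤-trans (packs-length packs) covered⁺
    ; bounded  = bounded⁺
    }
    where
    open Invariant inv
    q⁺ : ℕ → ℕ
    q⁺ = raise q (exponent i) (suc (length pre))

    confined⁺ : Confined q⁺ (firstFit i Bs)
    confined⁺ d with K ∸ d ≤? exponent i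
    ... | yes _     = packs-drop-> (q d ⊔ suc (length pre)) packs (m≤n⊔m (q d) _)
                        (All-drop-mono Bs (m≤m⊔n (q d) _) (confined d))
    ... | no  K∸d≰e = packs-drop-All (q d) packs (≰⇒> K∸d≰e) (confined d)

    covered⁺ : length Bs ⊔ suc (length pre) ≤ q⁺ K
    covered⁺ with K ∸ K ≤? exponent i
    ... | yes _     = ⊔-monoˡ-≤ (suc (length pre)) covered
    -- `K ∸ K` is 0, so every arrival brings `q K` at least up to the receiving bin.
    ... | no  K∸K≰e = contradiction (subst (_≤ exponent i) (sym (n∸n≡0 K)) z≤n) K∸K≰e

    passed : ∀ d → d ≤ K → K ∸ d ≤ exponent i →
             4 ^ K * suc (length pre) ≤ 4 ^ K * suc m + slack q d
    passed d d≤K K∸d≤e = begin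
      -- The receiving bin need not be full; it accounts for the extra 1 in `suc m`.
      4 ^ K * suc (length pre)                ≡⟨ *-suc (4 ^ K) (length pre) ⟩
      4 ^ K + 4 ^ K * length pre              ≤⟨ +-monoʳ-≤ (4 ^ K) fewBins ⟩
      4 ^ K + (4 ^ K * m + slack q d)         ≡⟨ +-assoc (4 ^ K) _ _ ⟨
      4 ^ K + 4 ^ K * m + slack q d           ≡⟨ cong (_+ slack q d) (*-suc (4 ^ K) m) ⟨
      4 ^ K * suc m + slack q d               ∎
      where
      open ≤-Reasoning
      -- Fine enough for every exponent present, and at least `K` so that 4ᴷ divides 4ᴺ.
      N = K + max 0 (map exponent P)
      u = 4 ^ (N ∸ K)
      exponents≤N : All (λ i → exponent i ≤ N) P
      exponents≤N = All.map (λ e≤ → ≤-trans e≤ (m≤n+m _ K)) (All.map⁻ (xs≤max 0 (map exponent P)))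
      K≤N : K ≤ N
      K≤N = m≤m+n K _
      commute : ∀ a b u → a * b * u ≡ b * (a * u)
      commute = solve-∀
      expand : ∀ a b u s → b * (a * u) + s * u ≡ (a * b + s) * u
      expand = solve-∀
      fewBins : 4 ^ K * length pre ≤ 4 ^ K * m + slack q d
      fewBins = *-cancelʳ-≤ _ _ u {{m^n≢0 4 (N ∸ K)}} (begin
        4 ^ K * length pre * u             ≡⟨ commute (4 ^ K) (length pre) u ⟩
        length pre * (4 ^ K * u)           ≡⟨ cong (length pre *_) (4^-split K≤N) ⟨
        length pre * 4 ^ N
          ≤⟨ fullBins N i d pre q K≤N d≤K K∸d≤e
               (λ d → packs-drop-pre (q d) packs (confined d)) (packs-full packs) ⟩
        totalLoad N pre + slack q d * u    ≤⟨ +-monoˡ-≤ _ (packs-totalLoad N packs) ⟩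
        totalLoad N Bs + slack q d * u     ≡⟨ cong (_+ slack q d * u) (totalLoad-concat N Bs) ⟩
        load N (concat Bs) + slack q d * u ≡⟨ cong (_+ slack q d * u) (load-↭ N Bs↭P) ⟩
        load N P + slack q d * u           ≤⟨ +-monoˡ-≤ _ (dominated N exponents≤N) ⟩
        m * 4 ^ N + slack q d * u          ≡⟨ cong (λ t → m * t + slack q d * u) (4^-split K≤N) ⟩
        m * (4 ^ K * u) + slack q d * u    ≡⟨ expand (4 ^ K) m u (slack q d) ⟩
        (4 ^ K * m + slack q d) * u        ∎)

    bounded⁺ : ∀ d → d ≤ K → 4 ^ K * q⁺ d ≤ 4 ^ K * suc m + slack q⁺ d
    bounded⁺ d d≤K = ≤-trans bounded-q (+-monoʳ-≤ (4 ^ K * suc m) (slack-mono d (q≤raise q _ _)))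
      where
      bounded-q : 4 ^ K * q⁺ d ≤ 4 ^ K * suc m + slack q d
      bounded-q with K ∸ d ≤? exponent i
      ... | yes K∸d≤e = subst (_≤ 4 ^ K * suc m + slack q d)
                          (sym (*-distribˡ-⊔ (4 ^ K) (q d) _)) (⊔-lub (bounded d d≤K) (passed d d≤K K∸d≤e))
      ... | no  _     = bounded d d≤K

  invariant-run : ∀ {m} es P Bs → All (λ P → Dominated P m) (scanl update P es) →
                  concat Bs ↭ P → Invariant m Bs → All (Invariant m) (scanl stepFF Bs es)
  invariant-run []              P Bs _          Bs↭P inv = inv ∷ []
  invariant-run (arrive i ∷ es) P Bs (dom ∷ doms) Bs↭P inv = inv ∷
    invariant-run es (i ∷ P) (firstFit i Bs) doms
      (↭-trans (packs-concat (proj₂ (firstFit-packs i Bs))) (prep i Bs↭P))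
      -- The bins passed over hold only squares present before the arrival, so the area bound of
      -- that earlier moment applies.
      (invariant-firstFit i dom Bs↭P inv)
  invariant-run (depart n ∷ es) P Bs (dom ∷ doms) Bs↭P inv = inv ∷
    invariant-run es (discard n P) (map (discard n) Bs) doms
      (↭-trans (↭-reflexive (concat-discard n Bs)) (filter-↭ (λ i → ¬? (ident i ≟ n)) Bs↭P))
      (invariant-discard n inv)

-- Solving the inequalities for `K` = 4

active≤length : ∀ {a} {A : Set a} (Bs : List (List A)) → active Bs ≤ length Bs
active≤length []             = z≤n
active≤length ([] ∷ Bs)      = m≤n⇒m≤1+n (active≤length Bs)
active≤length ((_ ∷ _) ∷ Bs) = s≤s (active≤length Bs)

-- All bounds have denominator 1020 = 4 · 255; only the one for q 2 is rounded up.
invariant⇒length : ∀ {m Bs} → Invariant 4 m Bs → 261120 * length Bs ≤ 577087 * suc m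
invariant⇒length {m} {Bs} inv = ≤-trans (*-monoʳ-≤ 261120 covered) h₄
  where
  open Invariant inv
  open ≤-Reasoning
  M = suc m
  expand₁ : ∀ m x₀ → 1020 * (256 * m + (x₀ + 3 * x₀)) ≡ 261120 * m + 4 * (1020 * x₀)
  expand₁ = solve-∀
  expand₂ : ∀ m x₀ x₁ → 1020 * (256 * m + (x₀ + 3 * x₀ + 12 * x₁)) ≡
            261120 * m + 4 * (1020 * x₀) + 12 * (1020 * x₁)
  expand₂ = solve-∀
  expand₃ : ∀ m x₀ x₁ x₂ → 1020 * (256 * m + (x₀ + 3 * x₀ + 12 * x₁ + 48 * x₂)) ≡
            261120 * m + 4 * (1020 * x₀) + 12 * (1020 * x₁) + 48 * (1020 * x₂)
  expand₃ = solve-∀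
  expand₄ : ∀ m x₀ x₁ x₂ x₃ → 1020 * (256 * m + (x₀ + 3 * x₀ + 12 * x₁ + 48 * x₂ + 192 * x₃)) ≡
            261120 * m + 4 * (1020 * x₀) + 12 * (1020 * x₁) + 48 * (1020 * x₂) + 192 * (1020 * x₃)
  expand₄ = solve-∀
  sum₁ : ∀ m → 261120 * m + 4 * (1024 * m) ≡ 256 * (1036 * m)
  sum₁ = solve-∀
  sum₂ : ∀ m → 261120 * m + 4 * (1024 * m) + 12 * (1036 * m) ≡ 277648 * m
  sum₂ = solve-∀
  sum₃ : ∀ m → 261120 * m + 4 * (1024 * m) + 12 * (1036 * m) + 48 * (1085 * m) ≡ 256 * (1288 * m)
  sum₃ = solve-∀
  sum₄ : ∀ m → 261120 * m + 4 * (1024 * m) + 12 * (1036 * m) + 48 * (1085 * m) + 192 * (1288 * m) ≡ 577024 * m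
  sum₄ = solve-∀
  scale : ∀ x → 256 * (1020 * x) ≡ 1020 * (256 * x)
  scale = solve-∀
  h₀ : 1020 * q 0 ≤ 1024 * M
  h₀ = begin
    1020 * q 0         ≡⟨ *-assoc 4 255 (q 0) ⟩
    -- The slack at 0 is `q 0` itself, so one of its 256 copies cancels; this is the origin of the
    -- factor 255 in the denominator.
    4 * (255 * q 0)    ≤⟨ *-monoʳ-≤ 4 (+-cancelʳ-≤ (q 0) _ _
                            (subst (_≤ 256 * M + q 0) (+-comm (q 0) (255 * q 0)) (bounded 0 z≤n))) ⟩
    4 * (256 * M)      ≡⟨ *-assoc 4 256 M ⟨
    1024 * M           ∎
  h₁ : 1020 * q 1 ≤ 1036 * M
  h₁ = *-cancelˡ-≤ 256 (begin
    256 * (1020 * q 1)                     ≡⟨ scale (q 1) ⟩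
    1020 * (256 * q 1)                     ≤⟨ *-monoʳ-≤ 1020 (bounded 1 (s≤s z≤n)) ⟩
    1020 * (256 * M + slack q 1)           ≡⟨ expand₁ M (q 0) ⟩
    261120 * M + 4 * (1020 * q 0)          ≤⟨ +-monoʳ-≤ (261120 * M) (*-monoʳ-≤ 4 h₀) ⟩
    261120 * M + 4 * (1024 * M)            ≡⟨ sum₁ M ⟩
    256 * (1036 * M)                       ∎)
  h₂ : 1020 * q 2 ≤ 1085 * M
  h₂ = *-cancelˡ-≤ 256 (begin
    256 * (1020 * q 2)                     ≡⟨ scale (q 2) ⟩
    1020 * (256 * q 2)                     ≤⟨ *-monoʳ-≤ 1020 (bounded 2 (s≤s (s≤s z≤n))) ⟩
    1020 * (256 * M + slack q 2)           ≡⟨ expand₂ M (q 0) (q 1) ⟩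
    261120 * M + 4 * (1020 * q 0) + 12 * (1020 * q 1)
      ≤⟨ +-mono-≤ (+-monoʳ-≤ (261120 * M) (*-monoʳ-≤ 4 h₀)) (*-monoʳ-≤ 12 h₁) ⟩
    261120 * M + 4 * (1024 * M) + 12 * (1036 * M)
      ≡⟨ sum₂ M ⟩
    277648 * M                             ≤⟨ *-monoˡ-≤ M (≤ᵇ⇒≤ 277648 277760 _) ⟩
    277760 * M                             ≡⟨ *-assoc 256 1085 M ⟩
    256 * (1085 * M)                       ∎)
  h₃ : 1020 * q 3 ≤ 1288 * M
  h₃ = *-cancelˡ-≤ 256 (begin
    256 * (1020 * q 3)                     ≡⟨ scale (q 3) ⟩
    1020 * (256 * q 3)                     ≤⟨ *-monoʳ-≤ 1020 (bounded 3 (s≤s (s≤s (s≤s z≤n)))) ⟩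
    1020 * (256 * M + slack q 3)           ≡⟨ expand₃ M (q 0) (q 1) (q 2) ⟩
    261120 * M + 4 * (1020 * q 0) + 12 * (1020 * q 1) + 48 * (1020 * q 2)
      ≤⟨ +-mono-≤ (+-mono-≤ (+-monoʳ-≤ (261120 * M) (*-monoʳ-≤ 4 h₀)) (*-monoʳ-≤ 12 h₁)) (*-monoʳ-≤ 48 h₂) ⟩
    261120 * M + 4 * (1024 * M) + 12 * (1036 * M) + 48 * (1085 * M)
      ≡⟨ sum₃ M ⟩
    256 * (1288 * M)                       ∎)
  h₄ : 261120 * q 4 ≤ 577087 * M
  h₄ = begin
    261120 * q 4                           ≡⟨ *-assoc 1020 256 (q 4) ⟩
    1020 * (256 * q 4)                     ≤⟨ *-monoʳ-≤ 1020 (bounded 4 ≤-refl) ⟩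
    1020 * (256 * M + slack q 4)           ≡⟨ expand₄ M (q 0) (q 1) (q 2) (q 3) ⟩
    261120 * M + 4 * (1020 * q 0) + 12 * (1020 * q 1) + 48 * (1020 * q 2) + 192 * (1020 * q 3)
      ≤⟨ +-mono-≤ (+-mono-≤ (+-mono-≤ (+-monoʳ-≤ (261120 * M) (*-monoʳ-≤ 4 h₀)) (*-monoʳ-≤ 12 h₁))
           (*-monoʳ-≤ 48 h₂)) (*-monoʳ-≤ 192 h₃) ⟩
    261120 * M + 4 * (1024 * M) + 12 * (1036 * M) + 48 * (1085 * M) + 192 * (1288 * M)
      ≡⟨ sum₄ M ⟩
    -- The inequalities give 577024, slightly better than the numerator claimed.
    577024 * M                             ≤⟨ *-monoˡ-≤ M (≤ᵇ⇒≤ 577024 577087 _) ⟩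
    577087 * M                             ∎

-- Area of disjoint squares

-- Pigeonhole: an occurrence of the head is deleted from `ys`, and uniqueness keeps the remaining
-- entries off it.
Unique-⊆⇒length≤ : ∀ {a} {A : Set a} {xs ys : List A} → Unique xs → xs ⊆ ys → length xs ≤ length ys
Unique-⊆⇒length≤ {xs = []}     []             xs⊆ys = z≤n
Unique-⊆⇒length≤ {xs = x ∷ xs} (x∉xs ∷ uniq) xs⊆ys with ∈-∃++ (xs⊆ys (here refl))
... | ys₁ , ys₂ , refl = subst (suc (length xs) ≤_) (sym (length-++-sucʳ ys₁ x ys₂))
        (s≤s (Unique-⊆⇒length≤ uniq others))
  where
  others : xs ⊆ ys₁ ++ ys₂
  others y∈xs with ∈-++⁻ ys₁ (xs⊆ys (there y∈xs))
  ... | inj₁ y∈ys₁          = ∈-++⁺ˡ y∈ys₁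
  ... | inj₂ (here refl)    = contradiction refl (All.lookup x∉xs y∈xs)
  ... | inj₂ (there y∈ys₂)  = ∈-++⁺ʳ ys₁ y∈ys₂

length-cartesianProduct : ∀ {a b} {A : Set a} {B : Set b} (xs : List A) (ys : List B) →
                          length (cartesianProduct xs ys) ≡ length xs * length ys
length-cartesianProduct []       ys = refl
length-cartesianProduct (x ∷ xs) ys = trans (length-++ (map (x ,_) ys))
  (cong₂ _+_ (length-map (x ,_) ys) (length-cartesianProduct xs ys))

length-concat : ∀ {a} {A : Set a} (xss : List (List A)) → length (concat xss) ≡ sum (map length xss)
length-concat []         = refl
length-concat (xs ∷ xss) = trans (length-++ xs) (cong (length xs +_) (length-concat xss))

record GridSquare : Set where
  field
    left bottom width : ℕ

open GridSquare

Apart : (a s b t : ℕ) → Set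
Apart a s b t = a + s ≤ b ⊎ b + t ≤ a

Separated : GridSquare → GridSquare → Set
Separated s t = Apart (left s) (width s) (left t) (width t) ⊎ Apart (bottom s) (width s) (bottom t) (width t)

InGrid : ℕ → GridSquare → Set
InGrid G s = left s + width s ≤ G × bottom s + width s ≤ G

interval : ℕ → ℕ → List ℕ
interval a n = applyUpTo (a +_) n

∈-interval⁻ : ∀ {x} a n → x ∈ interval a n → a ≤ x × x ℕ.< a + n
∈-interval⁻ a n x∈ with ∈-applyUpTo⁻ (a +_) x∈
... | i , i<n , refl = m≤m+n a i , +-monoʳ-< a i<n

apart⇒disjoint : ∀ {a s b t} → Apart a s b t → Disjoint (interval a s) (interval b t)
apart⇒disjoint {a} {s} {b} {t} apart (x∈₁ , x∈₂) =
  let a≤x , x<a+s = ∈-interval⁻ a s x∈₁ ; b≤x , x<b+t = ∈-interval⁻ b t x∈₂ in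
  case apart of λ
    { (inj₁ a+s≤b) → <-irrefl refl (<-≤-trans x<a+s (≤-trans a+s≤b b≤x))
    ; (inj₂ b+t≤a) → <-irrefl refl (<-≤-trans x<b+t (≤-trans b+t≤a a≤x)) }

-- Unit cells are named by their lower left corners. The intervals are half-open, so squares that
-- merely touch share no cell.
cells : GridSquare → List (ℕ × ℕ)
cells s = cartesianProduct (interval (left s) (width s)) (interval (bottom s) (width s))

∈-cells⁻ : ∀ s {x y} → (x , y) ∈ cells s → x ∈ interval (left s) (width s) × y ∈ interval (bottom s) (width s)
∈-cells⁻ s = ∈-cartesianProduct⁻ (interval (left s) (width s)) (interval (bottom s) (width s))

separated⇒disjoint : ∀ {s t} → Separated s t → Disjoint (cells s) (cells t)
separated⇒disjoint {s} {t} (inj₁ apart) (v∈s , v∈t) =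
  apart⇒disjoint apart (proj₁ (∈-cells⁻ s v∈s) , proj₁ (∈-cells⁻ t v∈t))
separated⇒disjoint {s} {t} (inj₂ apart) (v∈s , v∈t) =
  apart⇒disjoint apart (proj₂ (∈-cells⁻ s v∈s) , proj₂ (∈-cells⁻ t v∈t))

unique-interval : ∀ a n → Unique (interval a n)
unique-interval a n = Unique.applyUpTo⁺₁ (a +_) n λ i<j _ eq → <⇒≢ i<j (+-cancelˡ-≡ a _ _ eq)

unique-cells : ∀ s → Unique (cells s)
unique-cells s = Unique.cartesianProduct⁺ (unique-interval (left s) (width s)) (unique-interval (bottom s) (width s))

length-cells : ∀ s → length (cells s) ≡ width s * width s
length-cells s = trans (length-cartesianProduct (interval (left s) (width s)) _)
  (cong₂ _*_ (length-applyUpTo (left s +_) (width s)) (length-applyUpTo (bottom s +_) (width s)))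

-- Area is a count of unit cells: those of separated squares are pairwise distinct and all lie among
-- the `G * G` cells of the grid.
grid-area : ∀ G ss → All (InGrid G) ss → AllPairs Separated ss →
            sum (map (λ s → width s * width s) ss) ≤ G * G
grid-area G ss ins seps = begin
  sum (map (λ s → width s * width s) ss)   ≡⟨ cong sum (map-cong length-cells ss) ⟨
  sum (map (λ s → length (cells s)) ss)    ≡⟨ cong sum (map-∘ ss) ⟩
  sum (map length (map cells ss))          ≡⟨ length-concat (map cells ss) ⟨
  length (concat (map cells ss))
    ≤⟨ Unique-⊆⇒length≤
         (Unique.concat⁺ (All.map⁺ (All.universal unique-cells ss))
           (AllPairs.map⁺ (AllPairs.map separated⇒disjoint seps)))
         (λ v∈ → covered v∈) ⟩
  length (cartesianProduct (upTo G) (upTo G)) ≡⟨ length-cartesianProduct (upTo G) (upTo G) ⟩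
  length (upTo G) * length (upTo G)        ≡⟨ cong₂ _*_ (length-upTo G) (length-upTo G) ⟩
  G * G                                    ∎
  where
  open ≤-Reasoning
  covered : concat (map cells ss) ⊆ cartesianProduct (upTo G) (upTo G)
  covered v∈ with ∈-concat⁻′ (map cells ss) v∈
  ... | _ , v∈cells , cells∈ with ∈-map⁻ cells cells∈
  ...   | s , s∈ss , refl =
    let x∈ , y∈ = ∈-cells⁻ s v∈cells
        x≤G , y≤G = All.lookup ins s∈ss
    in ∈-cartesianProduct⁺
         (∈-upTo⁺ (<-≤-trans (proj₂ (∈-interval⁻ (left s) (width s) x∈)) x≤G))
         (∈-upTo⁺ (<-≤-trans (proj₂ (∈-interval⁻ (bottom s) (width s) y∈)) y≤G))

-- Rounding real coordinates to a dyadic grid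

half^ : ℕ → ℚ
half^ e = ℚ._/_ 1ℤ (2 ^ e) {{m^n≢0 2 e}}

halve : ∀ n .{{_ : NonZero n}} .{{_ : NonZero (2 * n)}} → 1ℤ ℚ./ (2 * n) ℚ.+ 1ℤ ℚ./ (2 * n) ≡ 1ℤ ℚ./ n
halve (suc n) = ℚ.toℚᵘ-injective (begin-equality
  ℚ.toℚᵘ (p ℚ.+ p)             ≃⟨ ℚ.toℚᵘ-homo-+ p p ⟩
  ℚ.toℚᵘ p ℚᵘ.+ ℚ.toℚᵘ p       ≃⟨ ℚᵘ.+-cong (ℚ.toℚᵘ-fromℚᵘ pᵘ) (ℚ.toℚᵘ-fromℚᵘ pᵘ) ⟩
  pᵘ ℚᵘ.+ pᵘ                   ≃⟨ ℚᵘ.*≡* (cong ℤ.+_ (lemma (suc n))) ⟩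
  ℚᵘ.mkℚᵘ 1ℤ n                 ≃⟨ ℚ.toℚᵘ-fromℚᵘ (ℚᵘ.mkℚᵘ 1ℤ n) ⟨
  ℚ.toℚᵘ (1ℤ ℚ./ suc n)        ∎)
  where
  open ℚᵘ.≤-Reasoning
  p = 1ℤ ℚ./ (2 * suc n)
  pᵘ = ℚᵘ.mkℚᵘ 1ℤ (n + (suc n + 0))
  lemma : ∀ n → (1 * (2 * n) + 1 * (2 * n)) * n ≡ 1 * (2 * n * (2 * n))
  lemma = solve-∀

half^-suc : ∀ e → half^ (suc e) ℚ.+ half^ (suc e) ≡ half^ e
half^-suc e = halve (2 ^ e) {{m^n≢0 2 e}} {{m^n≢0 2 (suc e)}}

half^-multiple : ∀ k e → (2 ^ k) · half^ (k + e) ≡ half^ e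
half^-multiple zero    e = ℚ.+-identityʳ (half^ e)
half^-multiple (suc k) e = begin
  (2 ^ suc k) · half^ (suc k + e)          ≡⟨ cong (_· half^ (suc k + e)) (*-comm 2 (2 ^ k)) ⟩
  (2 ^ k * 2) · half^ (suc k + e)          ≡⟨ ×-assocˡ (half^ (suc k + e)) (2 ^ k) 2 ⟨
  (2 ^ k) · (2 · half^ (suc k + e))        ≡⟨ cong ((2 ^ k) ·_) two ⟩
  (2 ^ k) · half^ (k + e)                  ≡⟨ half^-multiple k e ⟩
  half^ e                                  ∎
  where
  open ≡-Reasoning
  two : 2 · half^ (suc k + e) ≡ half^ (k + e)
  two = trans (cong (half^ (suc k + e) ℚ.+_) (ℚ.+-identityʳ _)) (half^-suc (k + e))

half^-positive : ∀ e → 0ℚ ℚ.< half^ e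
half^-positive e = ℚ.positive⁻¹ (half^ e) {{ℚ.normalize-pos 1 (2 ^ e) {{m^n≢0 2 e}}}}

L<U : ∀ x {p q} → L x p → U x q → p ℚ.< q
L<U x {p} {q} Lp Uq = ℚ.≰⇒> λ q≤p → case ℚ.<-cmp p q of λ
  { (tri< p<q _ _)  → ℚ.<-irrefl refl (ℚ.<-≤-trans p<q q≤p)
  ; (tri≈ _ refl _) → disjoint x (Lp , Uq)
  ; (tri> _ _ q<p)  → disjoint x (L-lower x q<p Lp , Uq) }

module _ (Q : ℕ) where

  mesh : ℚ
  mesh = half^ Q

  mark : ℕ → ℚ
  mark n = n · mesh

  mark-last : mark (2 ^ Q) ≡ 1ℚ
  mark-last = trans (cong (λ k → (2 ^ Q) · half^ k) (sym (+-identityʳ Q))) (half^-multiple Q 0)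

  side-mark : ∀ {i} → exponent i ≤ Q → side i ≡ mark (2 ^ (Q ∸ exponent i))
  side-mark {i} e≤Q = sym (trans (cong (λ k → (2 ^ (Q ∸ exponent i)) · half^ k) (sym (m∸n+n≡m e≤Q)))
    (half^-multiple (Q ∸ exponent i) (exponent i)))

  mark-suc : ∀ n → mark n ℚ.< mark (suc n)
  mark-suc n = subst (ℚ._< mark (suc n)) (ℚ.+-identityˡ (mark n)) (ℚ.+-monoˡ-< (mark n) (half^-positive Q))

  mark-mono : ∀ {m n} → m ≤ n → mark m ℚ.≤ mark n
  mark-mono {n = zero}  z≤n = ℚ.≤-refl
  mark-mono {n = suc n} z≤n = ℚ.≤-trans (mark-mono {n = n} z≤n) (ℚ.<⇒≤ (mark-suc n))
  mark-mono (s≤s m≤n) = ℚ.+-monoʳ-≤ mesh (mark-mono m≤n)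

  mark-cancel-< : ∀ {m n} → mark m ℚ.< mark n → m ℕ.< n
  mark-cancel-< lt = ≰⇒> λ n≤m → ℚ.<-irrefl refl (ℚ.<-≤-trans lt (mark-mono n≤m))

  -- Up to one mesh width, a is the position of x on the grid.
  record Near (x : ℝ) (a : ℕ) : Set where
    constructor near
    field
      above : L x (mark a ℚ.- mesh)
      below : U x (mark (suc a))

  open Near

  mark-pred : ∀ a → mark (suc a) ℚ.- mesh ≡ mark a
  mark-pred a = solve 2 (λ e m → (e :+ m) :- e := m) refl mesh (mark a)
    where open +-*-Solver

  -- The order on cuts is not decidable. Locatedness only chooses between the overlapping cases
  -- `mark a` < x and x < `mark (suc a)`; the search advances in the first case and stops in the
  -- second.
  near-exists : ∀ x s → 0ℚ ℚ.≤ s → fromℚ 0ℚ ≤ᴿ x → x ⊕ s ≤ᴿ fromℚ 1ℚ → ∃[ a ] Near x a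
  near-exists x s 0≤s 0≤x x+s≤1 = search (2 ^ Q) 0 (+-identityʳ (2 ^ Q))
    (0≤x _ (subst (ℚ._< 0ℚ) (sym (ℚ.+-identityˡ (ℚ.- mesh))) (ℚ.neg-antimono-< (half^-positive Q))))
    where
    search : ∀ f a → f + a ≡ 2 ^ Q → L x (mark a ℚ.- mesh) → ∃[ a ] Near x a
    search f a f+a≡G La with located x (mark-suc a)
    ... | inj₂ Ua = a , near La Ua
    search (suc f) a f+a≡G La | inj₁ La′ =
      search f (suc a) (trans (+-suc f a) f+a≡G) (subst (L x) (sym (mark-pred a)) La′)
    -- Having passed the last grid point would mean 1 < x, against x + s ≤ 1.
    search zero    a refl  La | inj₁ La′ =
      contradiction (ℚ.<-≤-trans 1+s<1 (ℚ.+-monoʳ-≤ 1ℚ 0≤s)) (ℚ.<-irrefl refl)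
      where
      1+s<1 : 1ℚ ℚ.+ s ℚ.< 1ℚ
      1+s<1 = x+s≤1 _ (subst (L x) (trans mark-last (solve 2 (λ o s → o := (o :+ s) :- s) refl 1ℚ s)) La′)
        where open +-*-Solver

  -- In mesh widths, a - 1 < x, y < b + 1 and x + s ≤ y give a - 1 + s < b + 1. Shrinking the width
  -- by one thus restores exact separation on the grid.
  near-≤ : ∀ x y {a b} s → L x (mark a ℚ.- mesh) → U y (mark (suc b)) → 0 ℕ.< s →
           x ⊕ mark s ≤ᴿ y → a + pred s ≤ b
  near-≤ x y {a} {b} (suc s) La Ub _ x+s≤y = s≤s⁻¹ a+s<b+1
    where
    open +-*-Solver
    shifted : L x (mark a ℚ.+ mark s ℚ.- mark (suc s))
    shifted = subst (L x) (solve 3 (λ a s e → a :- e := (a :+ s) :- (e :+ s)) refl (mark a) (mark s) mesh) La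
    a+s<b+1 : a + s ℕ.< suc b
    a+s<b+1 = mark-cancel-< (subst (ℚ._< mark (suc b)) (sym (×-homo-+ mesh a s)) (L<U y (x+s≤y _ shifted) Ub))

  width^ : Item → ℕ
  width^ i = 2 ^ (Q ∸ exponent i)

  record OnGrid (p : Placed) : Set where
    constructor on-grid
    field
      fine   : exponent (content p) ≤ Q
      {a b}  : ℕ
      near-x : Near (xpos p) a
      near-y : Near (ypos p) b

  -- One mesh width is given up to the inexact position.
  gridSquare : ∀ {p} → OnGrid p → GridSquare
  gridSquare {p} (on-grid _ {a} {b} _ _) = record { left = a ; bottom = b ; width = pred (width^ (content p)) }

  onGrid : ∀ {p} → exponent (content p) ≤ Q → InsideBin p → OnGrid p
  onGrid {placed i x y} e≤Q ((0≤x , x≤1) , (0≤y , y≤1)) =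
    let 0≤s = ℚ.<⇒≤ (half^-positive (exponent i))
        a , near-a = near-exists x (side i) 0≤s 0≤x x≤1
        b , near-b = near-exists y (side i) 0≤s 0≤y y≤1
    in on-grid e≤Q near-a near-b

  width^>0 : ∀ i → 0 ℕ.< width^ i
  width^>0 i = m^n>0 2 (Q ∸ exponent i)

  shrunk-≤ : ∀ i x y {a b} → exponent i ≤ Q → Near x a → U y (mark (suc b)) → x ⊕ side i ≤ᴿ y →
             a + pred (width^ i) ≤ b
  shrunk-≤ i x y e≤Q (near La _) Ub x+s≤y =
    near-≤ x y (width^ i) La Ub (width^>0 i) (subst (λ s → x ⊕ s ≤ᴿ y) (side-mark {i} e≤Q) x+s≤y)

  gridSquare-inGrid : ∀ {p} (g : OnGrid p) → InsideBin p → InGrid (2 ^ Q) (gridSquare g)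
  gridSquare-inGrid {placed i x y} (on-grid e≤Q near-a near-b) ((_ , x≤1) , (_ , y≤1)) =
    shrunk-≤ i x (fromℚ 1ℚ) e≤Q near-a end x≤1 , shrunk-≤ i y (fromℚ 1ℚ) e≤Q near-b end y≤1
    where
    -- The far edge 1 of the bin is treated as a coordinate with grid position `2 ^ Q`, so
    -- containment follows in the same way as separation.
    end : 1ℚ ℚ.< mark (suc (2 ^ Q))
    end = subst (ℚ._< mark (suc (2 ^ Q))) mark-last (mark-suc (2 ^ Q))

  gridSquare-separated : ∀ {p p′} (g : OnGrid p) (g′ : OnGrid p′) → NonOverlapping p p′ →
                         Separated (gridSquare g) (gridSquare g′)
  gridSquare-separated {placed i x y} {placed j x′ y′}
    (on-grid i≤Q near-a near-b) (on-grid j≤Q near-a′ near-b′) = λ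
    { (inj₁ (inj₁ le)) → inj₁ (inj₁ (shrunk-≤ i x x′ i≤Q near-a (below near-a′) le))
    ; (inj₁ (inj₂ le)) → inj₁ (inj₂ (shrunk-≤ j x′ x j≤Q near-a′ (below near-a) le))
    ; (inj₂ (inj₁ le)) → inj₂ (inj₁ (shrunk-≤ i y y′ i≤Q near-b (below near-b′) le))
    ; (inj₂ (inj₂ le)) → inj₂ (inj₂ (shrunk-≤ j y′ y j≤Q near-b′ (below near-b) le)) }

  gridSquares : ∀ {ps} → All OnGrid ps → List GridSquare
  gridSquares = All.reduce gridSquare

  gridSquares-inGrid : ∀ {ps} (gs : All OnGrid ps) → All InsideBin ps → All (InGrid (2 ^ Q)) (gridSquares gs)
  gridSquares-inGrid []       []         = []
  gridSquares-inGrid (g ∷ gs) (in₁ ∷ ins) = gridSquare-inGrid g in₁ ∷ gridSquares-inGrid gs ins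

  gridSquares-separated : ∀ {ps} (gs : All OnGrid ps) → AllPairs NonOverlapping ps →
                          AllPairs Separated (gridSquares gs)
  gridSquares-separated []       []            = []
  gridSquares-separated (g ∷ gs) (apart ∷ nos) = from g gs apart ∷ gridSquares-separated gs nos
    where
    from : ∀ {p ps} (g : OnGrid p) (gs : All OnGrid ps) → All (NonOverlapping p) ps →
           All (Separated (gridSquare g)) (gridSquares gs)
    from g []        []         = []
    from g (g′ ∷ gs) (ap ∷ aps) = gridSquare-separated g g′ ap ∷ from g gs aps

  shrunk-area : ∀ {ps} → All InsideBin ps → AllPairs NonOverlapping ps →
                All (λ p → exponent (content p) ≤ Q) ps →
                sum (map (λ p → pred (width^ (content p)) * pred (width^ (content p))) ps) ≤ 2 ^ Q * 2 ^ Q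
  shrunk-area {ps} ins nos es = subst (_≤ 2 ^ Q * 2 ^ Q) (cong sum (widths gs))
    (grid-area (2 ^ Q) (gridSquares gs) (gridSquares-inGrid gs ins) (gridSquares-separated gs nos))
    where
    gs : All OnGrid ps
    gs = All.zipWith (λ (e≤Q , inside) → onGrid e≤Q inside) (es , ins)
    widths : ∀ {ps} (gs : All OnGrid ps) →
      map (λ s → width s * width s) (gridSquares gs) ≡
      map (λ p → pred (width^ (content p)) * pred (width^ (content p))) ps
    widths []       = refl
    widths (g ∷ gs) = cong (_ ∷_) (widths gs)

-- Area of a bin as the mesh tends to 0

n<2^n : ∀ n → n ℕ.< 2 ^ n
n<2^n zero    = s≤s z≤n
n<2^n (suc n) = +-mono-≤ (m^n>0 2 n) (subst (n ℕ.<_) (sym (+-identityʳ (2 ^ n))) (n<2^n n))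

4^n≡2^n*2^n : ∀ n → 4 ^ n ≡ 2 ^ n * 2 ^ n
4^n≡2^n*2^n zero    = refl
4^n≡2^n*2^n (suc n) = trans (cong (4 *_) (4^n≡2^n*2^n n)) (lemma (2 ^ n))
  where
  lemma : ∀ a → 4 * (a * a) ≡ 2 * a * (2 * a)
  lemma = solve-∀

n*n≤pred²+2n : ∀ n → n * n ≤ pred n * pred n + 2 * n
n*n≤pred²+2n zero    = z≤n
n*n≤pred²+2n (suc n) = subst (suc n * suc n ≤_) (lemma n) (n≤1+n _)
  where
  lemma : ∀ n → suc (suc n * suc n) ≡ n * n + 2 * suc n
  lemma = solve-∀

-- Total side length in units of 2⁻ᴺ, a quarter of the geometric perimeter; it controls the area
-- lost to shrinking.
perimeter : ℕ → List Placed → ℕ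
perimeter N ps = sum (map (λ p → 2 ^ (N ∸ exponent (content p))) ps)

-- Refining the mesh by 2ʳ multiplies the area lost to shrinking by 2ʳ only,
-- whereas the areas themselves are multiplied by 4ʳ.
refined-area : ∀ N r ps → All (λ p → exponent (content p) ≤ N) ps →
  4 ^ r * load N (map content ps) ≤
  sum (map (λ p → pred (width^ (r + N) (content p)) * pred (width^ (r + N) (content p))) ps)
    + 2 * (2 ^ r * perimeter N ps)
refined-area N r []       []         = ≤-reflexive (trans (*-zeroʳ (4 ^ r)) (cong (2 *_) (sym (*-zeroʳ (2 ^ r)))))
refined-area N r (p ∷ ps) (e≤N ∷ es) = begin
  4 ^ r * (4 ^ (N ∸ e) + load N (map content ps))          ≡⟨ *-distribˡ-+ (4 ^ r) _ _ ⟩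
  4 ^ r * 4 ^ (N ∸ e) + 4 ^ r * load N (map content ps)    ≡⟨ cong (_+ 4 ^ r * load N (map content ps)) area ⟩
  w * w + 4 ^ r * load N (map content ps)
    ≤⟨ +-mono-≤ (n*n≤pred²+2n w) (refined-area N r ps es) ⟩
  pred w * pred w + 2 * w + (S + 2 * (2 ^ r * perimeter N ps))
    ≡⟨ cong (λ t → pred w * pred w + 2 * t + (S + 2 * (2 ^ r * perimeter N ps))) w≡ ⟩
  pred w * pred w + 2 * (2 ^ r * v) + (S + 2 * (2 ^ r * perimeter N ps))
    ≡⟨ regroup (pred w * pred w) (2 ^ r) v S (perimeter N ps) ⟩
  pred w * pred w + S + 2 * (2 ^ r * (v + perimeter N ps)) ∎
  where
  open ≤-Reasoning
  e = exponent (content p)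
  v = 2 ^ (N ∸ e)
  w = width^ (r + N) (content p)
  S = sum (map (λ p → pred (width^ (r + N) (content p)) * pred (width^ (r + N) (content p))) ps)
  w≡ : w ≡ 2 ^ r * v
  w≡ = trans (cong (2 ^_) (+-∸-assoc r e≤N)) (^-distribˡ-+-* 2 r (N ∸ e))
  area : 4 ^ r * 4 ^ (N ∸ e) ≡ w * w
  area = trans (sym (^-distribˡ-+-* 4 r (N ∸ e)))
    (trans (4^n≡2^n*2^n (r + (N ∸ e))) (cong (λ k → 2 ^ k * 2 ^ k) (sym (+-∸-assoc r e≤N))))
  regroup : ∀ a c v s t → a + 2 * (c * v) + (s + 2 * (c * t)) ≡ a + s + 2 * (c * (v + t))
  regroup = solve-∀

-- An overfull bin exceeds 4ᴺ by at least one unit. After refinement by 2ʳ this excess is at least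
-- 4ʳ, while shrinking loses at most 2ʳ times twice `perimeter N ps`.
bin-area : ∀ N ps → All InsideBin ps → AllPairs NonOverlapping ps →
           All (λ p → exponent (content p) ≤ N) ps → load N (map content ps) ≤ 4 ^ N
bin-area N ps ins nos es = ≮⇒≥ λ overfull → <-irrefl refl (<-≤-trans (n<2^n r) (2^r≤r overfull))
  where
  open ≤-Reasoning
  -- With this choice the comparison of excess and loss becomes 2ʳ ≤ r, which is absurd.
  r = 2 * perimeter N ps
  2^r≤r : 4 ^ N ℕ.< load N (map content ps) → 2 ^ r ≤ r
  2^r≤r overfull = *-cancelˡ-≤ (2 ^ r) {{m^n≢0 2 r}} (+-cancelˡ-≤ (4 ^ r * 4 ^ N) _ _ (begin
    4 ^ r * 4 ^ N + 2 ^ r * 2 ^ r      ≡⟨ cong (4 ^ r * 4 ^ N +_) (4^n≡2^n*2^n r) ⟨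
    4 ^ r * 4 ^ N + 4 ^ r              ≡⟨ +-comm _ (4 ^ r) ⟩
    4 ^ r + 4 ^ r * 4 ^ N              ≡⟨ *-suc (4 ^ r) (4 ^ N) ⟨
    4 ^ r * suc (4 ^ N)                ≤⟨ *-monoʳ-≤ (4 ^ r) overfull ⟩
    4 ^ r * load N (map content ps)    ≤⟨ refined-area N r ps es ⟩
    S + 2 * (2 ^ r * perimeter N ps)
      ≤⟨ +-monoˡ-≤ _ (shrunk-area (r + N) ins nos (All.map (λ e≤N → ≤-trans e≤N (m≤n+m N r)) es)) ⟩
    2 ^ (r + N) * 2 ^ (r + N) + 2 * (2 ^ r * perimeter N ps)
      ≡⟨ cong₂ _+_ (trans (sym (4^n≡2^n*2^n (r + N))) (^-distribˡ-+-* 4 r N)) (swap (2 ^ r) (perimeter N ps)) ⟩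
    4 ^ r * 4 ^ N + 2 ^ r * r          ∎))
    where
    S = sum (map (λ p → pred (width^ (r + N) (content p)) * pred (width^ (r + N) (content p))) ps)
    swap : ∀ a b → 2 * (a * b) ≡ a * (2 * b)
    swap = solve-∀

-- An empty bin adds neither to the load nor to `active`; every other bin holds area at most 1.
packing-area : ∀ N {P} (p : Packing P) → All (λ i → exponent i ≤ N) P → load N P ≤ active (bins p) * 4 ^ N
packing-area N {P} p es = subst (_≤ active (bins p) * 4 ^ N) (load-↭ N (contents p))
  (binsArea (bins p) (inside p) (nonoverlapping p) (All.map⁻ (All-resp-↭ (↭-sym (contents p)) es)))
  where
  binsArea : ∀ bs → All (All InsideBin) bs → All (AllPairs NonOverlapping) bs →
             All (λ q → exponent (content q) ≤ N) (concat bs) →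
             load N (map content (concat bs)) ≤ active bs * 4 ^ N
  binsArea []              []          []           es = z≤n
  binsArea ([] ∷ bs)       (_ ∷ ins)   (_ ∷ nos)    es = binsArea bs ins nos es
  binsArea (b@(_ ∷ _) ∷ bs) (in₁ ∷ ins) (ap ∷ aps)  es = begin
    load N (map content (b ++ concat bs))                     ≡⟨ cong (load N) (map-++ content b (concat bs)) ⟩
    load N (map content b ++ map content (concat bs))         ≡⟨ load-++ N (map content b) _ ⟩
    load N (map content b) + load N (map content (concat bs))
      ≤⟨ +-mono-≤ (bin-area N b in₁ ap (All.++⁻ˡ b es)) (binsArea bs ins aps (All.++⁻ʳ b es)) ⟩
    4 ^ N + active bs * 4 ^ N                                 ∎
    where open ≤-Reasoning

-- Opened only here, as the constructor +_ makes sections (m +_) of addition ambiguous.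
open import Data.Integer.Base using (+_)

-- Passage to rational numbers and conclusion

/-toℚᵘ : ∀ n d → ℚ.toℚᵘ (+ n ℚ./ suc d) ℚᵘ.≃ ℚᵘ.mkℚᵘ (+ n) d
/-toℚᵘ n d = ℚ.toℚᵘ-fromℚᵘ (ℚᵘ.mkℚᵘ (+ n) d)

-- The additive constant is the ratio itself, as n(o + 1)/d = (n/d)o + n/d.
affine-bound : ∀ n d .{{_ : NonZero d}} f o → d * f ≤ n * suc o →
  ℕ→ℚ f ℚ.≤ (+ n / d) ℚ.* ℕ→ℚ o ℚ.+ (+ n / d)
affine-bound n (suc d) f o le = ℚ.toℚᵘ-cancel-≤ (begin
  ℚ.toℚᵘ (ℕ→ℚ f)                                   ≃⟨ /-toℚᵘ f 0 ⟩
  ℚᵘ.mkℚᵘ (+ f) 0                                  ≤⟨ ℚᵘ.*≤* cross ⟩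
  ℚᵘ.mkℚᵘ (+ n) d ℚᵘ.* ℚᵘ.mkℚᵘ (+ o) 0 ℚᵘ.+ ℚᵘ.mkℚᵘ (+ n) d
    ≃⟨ ℚᵘ.+-cong (ℚᵘ.*-cong (/-toℚᵘ n d) (/-toℚᵘ o 0)) (/-toℚᵘ n d) ⟨
  ℚ.toℚᵘ c ℚᵘ.* ℚ.toℚᵘ (ℕ→ℚ o) ℚᵘ.+ ℚ.toℚᵘ c       ≃⟨ ℚᵘ.+-congˡ (ℚ.toℚᵘ c) (ℚ.toℚᵘ-homo-* c (ℕ→ℚ o)) ⟨
  ℚ.toℚᵘ (c ℚ.* ℕ→ℚ o) ℚᵘ.+ ℚ.toℚᵘ c               ≃⟨ ℚ.toℚᵘ-homo-+ (c ℚ.* ℕ→ℚ o) c ⟨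
  ℚ.toℚᵘ (c ℚ.* ℕ→ℚ o ℚ.+ c)                       ∎)
  where
  open ℚᵘ.≤-Reasoning
  c = + n ℚ./ suc d
  cross : + f ℤ.* + (suc d * 1 * suc d) ℤ.≤ (+ n ℤ.* + o ℤ.* + suc d ℤ.+ + n ℤ.* + (suc d * 1)) ℤ.* + 1
  cross = subst₂ ℤ._≤_ (ℤ.pos-* f (suc d * 1 * suc d)) right (ℤ.+≤+ natural)
    where
    right : + ((n * o * suc d + n * (suc d * 1)) * 1) ≡
            (+ n ℤ.* + o ℤ.* + suc d ℤ.+ + n ℤ.* + (suc d * 1)) ℤ.* + 1
    right = trans (ℤ.pos-* (n * o * suc d + n * (suc d * 1)) 1) (cong (ℤ._* + 1) (cong₂ ℤ._+_
      (trans (ℤ.pos-* (n * o) (suc d)) (cong (ℤ._* + suc d) (ℤ.pos-* n o))) (ℤ.pos-* n (suc d * 1))))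
    regroupˡ : ∀ f e → e * (e * f) ≡ f * (e * 1 * e)
    regroupˡ = solve-∀
    regroupʳ : ∀ n o e → e * (n * suc o) ≡ (n * o * e + n * (e * 1)) * 1
    regroupʳ = solve-∀
    natural : f * (suc d * 1 * suc d) ≤ (n * o * suc d + n * (suc d * 1)) * 1
    natural = subst₂ _≤_ (regroupˡ f (suc d)) (regroupʳ n o (suc d)) (*-monoʳ-≤ (suc d) le)

dominated-by : ∀ {Ps m} (run : All Packing Ps) → All (_≤ m) (All.reduce (λ p → active (bins p)) run) →
               All (λ P → Dominated P m) Ps
dominated-by []        []         = []
dominated-by (p ∷ run) (le ∷ les) =
  (λ N es → ≤-trans (packing-area N p es) (*-monoˡ-≤ (4 ^ N) le)) ∷ dominated-by run les

FF-all : ∀ {p} {P : Pred ℕ p} σ → P 0 → All (λ Bs → P (active Bs)) (scanl stepFF [] (events σ)) → P (FF σ)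
FF-all {P = P} σ p₀ ps = argmax-all (λ n → n) {P = P} p₀ (All.map⁺ ps)

-- A run of cost `opt` has at most `opt` active bins at every moment, so the area present is
-- dominated by `opt` throughout and the invariant applies.
FF-bound : ∀ σ opt → IsOPT σ opt → 261120 * FF σ ≤ 577087 * suc opt
FF-bound σ opt ((run , cost≡opt) , _) =
  FF-all {P = Bounded} σ z≤n (All.map bounded runInvariant)
  where
  Bounded : ℕ → Set
  Bounded n = 261120 * n ≤ 577087 * suc opt
  runFF : List (List (List Item))
  runFF = scanl stepFF [] (events σ)
  costs≤opt : All (_≤ opt) (All.reduce (λ p → active (bins p)) run)
  costs≤opt = subst (λ m → All (_≤ m) _) cost≡opt (xs≤max 0 (All.reduce (λ p → active (bins p)) run))
  runInvariant : All (Invariant 4 opt) runFF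
  runInvariant = invariant-run 4 (events σ) [] [] (dominated-by run costs≤opt) ↭-refl (invariant-[] 4 opt)
  bounded : ∀ {Bs} → Invariant 4 opt Bs → Bounded (active Bs)
  bounded {Bs} inv = ≤-trans (*-monoʳ-≤ 261120 (active≤length Bs)) (invariant⇒length inv)

theorem5p2 : AsymptoticRatioAtMost FF (+ 577087 / 261120) × (+ 577087 / 261120) < (+ 2211 / 1000)
theorem5p2 = (+ 577087 / 261120 , λ σ opt isOPT → affine-bound 577087 261120 (FF σ) opt (FF-bound σ opt isOPT)) ,
  from-yes (+ 577087 / 261120 ℚ.<? + 2211 / 1000)
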